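{- For every integer $k\ge 1$, the choice index (list chromatic index) of the generalised Petersen graph $GP(3k,k)$ equals its chromatic index; that is, the list-colouring conjecture holds for $GP(3k,k)$.
   Context: For integers $n,k$ with $1\le k<n/2$, the generalised Petersen graph $GP(n,k)$ has vertex set $\{u_i,v_i : i\in\mathbb{Z}_n\}$ and edge set $\{u_iu_{i+1},\ u_iv_i,\ v_iv_{i+k} : i\in\mathbb{Z}_n\}$. The chromatic index of a graph is the least number of colours in a proper edge colouring. The choice index is the least $\ell$ such that for every assignment of lists $L_e$ of $\ell$ colours to the edges $e$, there is a proper edge colouring in which every edge $e$ receives a colour from $L_e$. -}

module Defs where

open import Data.Nat using (ℕ; suc; _+_; _*_; _/_; _%_; _≤_; _<_)
open import Data.Nat.DivMod using
  (_mod_; m%n<n; m≡m%n+[m/n]*n; m*n%n≡0; m<n⇒m%n≡m; %-distribˡ-+)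
open import Data.Nat.Properties
open import Data.Fin using (Fin; toℕ)
open import Data.Fin.Properties using (toℕ-fromℕ<; toℕ<n; nonZeroIndex)
open import Data.List using (List; length)
open import Data.List.Membership.Propositional using (_∈_)
open import Data.List.Relation.Unary.Unique.Propositional using (Unique)
open import Data.Product using (∃; _×_; _,_; proj₁; proj₂; swap)
open import Data.Sum using (_⊎_; inj₁; inj₂)
open import Relation.Nullary using (contradiction)
open import Relation.Binary.PropositionalEquality

-- Ordered pairs that represent the same unordered pair.
_≋_ : {V : Set} → V × V → V × V → Set
p ≋ q = p ≡ q ⊎ p ≡ swap q

-- The order of the two ends of an edge carries no information. By `simple`,
-- E indexes a set of unordered pairs of vertices without repetition.
record SimpleGraph : Set₁ where
  field
    V E      : Set
    ends     : E → V × V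
    loopless : ∀ e → proj₁ (ends e) ≢ proj₂ (ends e)
    simple   : ∀ e f → ends e ≋ ends f → e ≡ f

  _endOf_ : V → E → Set
  x endOf e = x ≡ proj₁ (ends e) ⊎ x ≡ proj₂ (ends e)

module _ (G : SimpleGraph) where
  open SimpleGraph G

  ProperEdgeColouring : {C : Set} → (E → C) → Set
  ProperEdgeColouring c =
    ∀ {e f x} → e ≢ f → x endOf e → x endOf f → c e ≢ c f

  EdgeColourable : ℕ → Set
  EdgeColourable ℓ = ∃ λ (c : E → Fin ℓ) → ProperEdgeColouring c

  -- Duplicate-free lists of length ℓ represent sets of ℓ colours.
  EdgeChoosable : ℕ → Set
  EdgeChoosable ℓ =
    (L : E → List ℕ) → (∀ e → Unique (L e)) → (∀ e → length (L e) ≡ ℓ) →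
    ∃ λ (c : E → ℕ) → ProperEdgeColouring c × (∀ e → c e ∈ L e)

IsLeast : (ℕ → Set) → ℕ → Set
IsLeast P m = P m × (∀ n → P n → m ≤ n)

IsChromaticIndex : SimpleGraph → ℕ → Set
IsChromaticIndex G = IsLeast (EdgeColourable G)

IsChoiceIndex : SimpleGraph → ℕ → Set
IsChoiceIndex G = IsLeast (EdgeChoosable G)

-- i ⊕ d is i + d in ℤ/n.
infixl 6 _⊕_
_⊕_ : ∀ {n} → Fin n → ℕ → Fin n
_⊕_ {n} i d = ((toℕ i + d) mod n) {{nonZeroIndex i}}

toℕ-⊕ : ∀ {n} (i : Fin (suc n)) d → toℕ (i ⊕ d) ≡ (toℕ i + d) % suc n
toℕ-⊕ {n} i d = toℕ-fromℕ< (m%n<n (toℕ i + d) (suc n))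

%-fixed⇒≡0 : ∀ {n a d} → d < suc n → (a + d) % suc n ≡ a → d ≡ 0
%-fixed⇒≡0 {n} {a} {d} d<n eq = begin
  d                     ≡⟨ m<n⇒m%n≡m d<n ⟨
  d % suc n             ≡⟨ cong (_% suc n) d≡qn ⟩
  (q * suc n) % suc n   ≡⟨ m*n%n≡0 q (suc n) ⟩
  0                     ∎
  where
  open ≡-Reasoning
  q : ℕ
  q = (a + d) / suc n
  d≡qn : d ≡ q * suc n
  d≡qn = +-cancelˡ-≡ a d (q * suc n)
    (trans (m≡m%n+[m/n]*n (a + d) (suc n)) (cong (_+ q * suc n) eq))

i≢i⊕d : ∀ {n d} (i : Fin n) → 0 < d → d < n → i ≢ i ⊕ d
i≢i⊕d {suc n} {d} i 0<d d<n eq =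
  contradiction (%-fixed⇒≡0 d<n (sym (trans (cong toℕ eq) (toℕ-⊕ i d)))) (m<n⇒n≢0 0<d)

⊕-⊕ : ∀ {n} (i : Fin (suc n)) d → toℕ (i ⊕ d ⊕ d) ≡ (toℕ i + (d + d)) % suc n
⊕-⊕ {n} i d = begin
  toℕ (i ⊕ d ⊕ d)                              ≡⟨ toℕ-⊕ (i ⊕ d) d ⟩
  (toℕ (i ⊕ d) + d) % N                        ≡⟨ %-distribˡ-+ (toℕ (i ⊕ d)) d N ⟩
  (toℕ (i ⊕ d) % N + d % N) % N                ≡⟨ cong (λ x → (x + d % N) % N) (m<n⇒m%n≡m (toℕ<n (i ⊕ d))) ⟩
  (toℕ (i ⊕ d) + d % N) % N                    ≡⟨ cong (λ x → (x + d % N) % N) (toℕ-⊕ i d) ⟩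
  ((toℕ i + d) % N + d % N) % N                ≡⟨ %-distribˡ-+ (toℕ i + d) d N ⟨
  (toℕ i + d + d) % N                          ≡⟨ cong (_% N) (+-assoc (toℕ i) d d) ⟩
  (toℕ i + (d + d)) % N                        ∎
  where
  open ≡-Reasoning
  N : ℕ
  N = suc n

i≢i⊕d⊕d : ∀ {n d} (i : Fin n) → 0 < d → d + d < n → i ≢ i ⊕ d ⊕ d
i≢i⊕d⊕d {suc n} {d} i 0<d 2d<n eq =
  contradiction (%-fixed⇒≡0 2d<n (sym (trans (cong toℕ eq) (⊕-⊕ i d))))
    (m<n⇒n≢0 (<-≤-trans 0<d (m≤m+n d d)))

data GPVertex (n : ℕ) : Set where
  u v : Fin n → GPVertex n

data GPEdge (n : ℕ) : Set where
  outer spoke inner : Fin n → GPEdge n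

gpEnds : ∀ {n} → ℕ → GPEdge n → GPVertex n × GPVertex n
gpEnds k (outer i) = u i , u (i ⊕ 1)
gpEnds k (spoke i) = u i , v i
gpEnds k (inner i) = v i , v (i ⊕ k)

-- The hypothesis k < n/2 is written 2k < n.
module _ (n k : ℕ) (1≤k : 1 ≤ k) (2k<n : 2 * k < n) where

  private
    k+k<n : k + k < n
    k+k<n = subst (λ x → k + x < n) (+-identityʳ k) 2k<n

    k<n : k < n
    k<n = ≤-<-trans (m≤m+n k k) k+k<n

    2<n : 1 + 1 < n
    2<n = ≤-<-trans (+-mono-≤ 1≤k 1≤k) k+k<n

    u-injective : ∀ {i j : Fin n} → u i ≡ u j → i ≡ j
    u-injective refl = refl

    v-injective : ∀ {i j : Fin n} → v i ≡ v j → i ≡ j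
    v-injective refl = refl

    gp-loopless : ∀ e → proj₁ (gpEnds {n} k e) ≢ proj₂ (gpEnds k e)
    gp-loopless (outer i) eq = i≢i⊕d i ≤-refl (≤-<-trans 1≤k k<n) (u-injective eq)
    gp-loopless (spoke i) ()
    gp-loopless (inner i) eq = i≢i⊕d i 1≤k k<n (v-injective eq)

    gp-simple : ∀ e f → gpEnds {n} k e ≋ gpEnds k f → e ≡ f
    gp-simple (outer i) (outer j) (inj₁ eq) = cong outer (u-injective (cong proj₁ eq))
    gp-simple (outer i) (outer j) (inj₂ eq) = contradiction
      (trans (u-injective (cong proj₁ eq))
             (cong (_⊕ 1) (sym (u-injective (cong proj₂ eq)))))
      (i≢i⊕d⊕d i ≤-refl 2<n)
    gp-simple (inner i) (inner j) (inj₁ eq) = cong inner (v-injective (cong proj₁ eq))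
    gp-simple (inner i) (inner j) (inj₂ eq) = contradiction
      (trans (v-injective (cong proj₁ eq))
             (cong (_⊕ k) (sym (v-injective (cong proj₂ eq)))))
      (i≢i⊕d⊕d i 1≤k k+k<n)
    gp-simple (spoke i) (spoke j) (inj₁ eq) = cong spoke (u-injective (cong proj₁ eq))
    gp-simple (spoke i) (spoke j) (inj₂ ())
    gp-simple (outer i) (spoke j) (inj₁ ())
    gp-simple (outer i) (spoke j) (inj₂ ())
    gp-simple (outer i) (inner j) (inj₁ ())
    gp-simple (outer i) (inner j) (inj₂ ())
    gp-simple (spoke i) (outer j) (inj₁ ())
    gp-simple (spoke i) (outer j) (inj₂ ())
    gp-simple (spoke i) (inner j) (inj₁ ())
    gp-simple (spoke i) (inner j) (inj₂ ())
    gp-simple (inner i) (outer j) (inj₁ ())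
    gp-simple (inner i) (outer j) (inj₂ ())
    gp-simple (inner i) (spoke j) (inj₁ ())
    gp-simple (inner i) (spoke j) (inj₂ ())

  GP : SimpleGraph
  GP = record
    { V        = GPVertex n
    ; E        = GPEdge n
    ; ends     = gpEnds k
    ; loopless = gp-loopless
    ; simple   = gp-simple
    }

2k<3k : ∀ {k} → 1 ≤ k → 2 * k < 3 * k
2k<3k {suc k} _ = *-monoˡ-< (suc k) {2} {3} ≤-refl

{-# OPTIONS --safe #-}
module Submission where

-- Lists of three colours suffice by the method of Alon and Tarsi. Give each edge e a variable x_e
-- and multiply the Vandermonde determinants of the triples of edges at the vertices: the product has
-- degree 2|E| and vanishes at the improper colourings. Apply to each variable the second divided
-- difference on the list of its edge. It kills degrees below 2, so only the coefficient N of ∏ x_e²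
-- survives, up to a nonzero factor, and if N ≠ 0 then some colouring from the lists is proper.
-- GP(3k,k) is a ring of k equal fibres, each a triangle with its three spokes and their outer ends,
-- closed up with a cyclic shift of the three strands. Hence N = tr(S Kᵏ) for a 27 × 27 integer
-- matrix K and a permutation S. Computation gives K³ = −3 K and nonzero traces for k = 1 and k = 2.

open import Defs
import Algebra.Properties.CommutativeSemigroup as CommutativeSemigroupProperties
open import Data.Fin as Fin using (Fin; zero; suc; toℕ; fromℕ; fromℕ<; inject₁; opposite; combine; remQuot)
open import Data.Fin.Patterns using (0F; 1F; 2F)
open import Data.Fin.Properties using (all?; toℕ<n; toℕ-injective; toℕ-fromℕ; toℕ-inject₁; fromℕ<-injective;
  toℕ-combine; combine-remQuot; remQuot-combine; injective⇒≤)
open import Data.Fin.Relation.Unary.Top using (View; view; ‵fromℕ; ‵inject₁)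
open import Data.Integer using (ℤ; +_; _+_; _-_; -_; _^_; 0ℤ; 1ℤ; -1ℤ; _≟_) renaming (_*_ to _·_)
import Data.Integer.Properties as ℤ
open import Data.Integer.Tactic.RingSolver using (ring; solve-∀)
open import Data.List as List using (List; length; upTo)
open import Data.List.Membership.Propositional using (_∈_)
open import Data.List.Membership.Propositional.Properties using (∈-lookup; ∈-upTo⁻)
open import Data.List.Properties using (length-upTo)
import Data.List.Relation.Unary.All as All
open import Data.List.Relation.Unary.AllPairs using (_∷_)
open import Data.List.Relation.Unary.Unique.Propositional using (Unique)
open import Data.List.Relation.Unary.Unique.Propositional.Properties using (upTo⁺)
open import Data.Nat as ℕ using (ℕ; zero; suc; _≤_; _<_; _%_; z≤n; s≤s; _*_)
open import Data.Nat.DivMod using (m<n⇒m%n≡m; m%n%n≡m%n; [m+n]%n≡m%n; %-distribˡ-+)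
import Data.Nat.Properties as ℕ
import Data.Nat.Tactic.RingSolver as ℕ-Solver
open import Data.Product using (∃; _×_; _,_; proj₁; proj₂)
open import Data.Sum using (_⊎_; inj₁; inj₂; [_,_]′)
open import Data.Unit using (⊤; tt)
open import Function using (_∘_; id)
open import Function.Definitions using (Injective)
open import Relation.Binary.Definitions using (tri<; tri≈; tri>)
open import Relation.Binary.PropositionalEquality
open import Relation.Nullary using (Dec; yes; no; contradiction)
open import Relation.Nullary.Decidable using (True; toWitness; _→-dec_; map′)
import Tactic.RingSolver.NonReflective as NonReflective

open CommutativeSemigroupProperties ℤ.*-commutativeSemigroup
  using (x∙yz≈y∙xz) renaming (interchange to *-interchange)
open CommutativeSemigroupProperties ℕ.+-commutativeSemigroup
  using () renaming (interchange to +-interchange)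

-- Sums and monomials over a bundle of edge ends

infixr 5 _⊗_

-- A shape is a bundle of edge ends; a tree over it gives one value per end, either the exponent of
-- the variable of the edge (at most 2, as each vertex contributes a Vandermonde determinant) or the
-- colour of the edge.
data Shape : Set where
  ∅ ∙ : Shape
  _⊗_ : Shape → Shape → Shape

Tree : Set → Shape → Set
Tree A ∅       = ⊤
Tree A ∙       = A
Tree A (s ⊗ t) = Tree A s × Tree A t

Exp : Shape → Set
Exp = Tree (Fin 3)

size : Shape → ℕ
size ∅       = 0
size ∙       = 1
size (s ⊗ t) = size s ℕ.+ size t

deg : ∀ s → Exp s → ℕ
deg ∅       _       = 0
deg ∙       a       = toℕ a
deg (s ⊗ t) (a , b) = deg s a ℕ.+ deg t b

mon : ∀ s → Tree ℕ s → Exp s → ℤ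
mon ∅       _       _       = 1ℤ
mon ∙       x       a       = (+ x) ^ toℕ a
mon (s ⊗ t) (x , y) (a , b) = mon s x a · mon t y b

∑ : ∀ s → (Exp s → ℤ) → ℤ
∑ ∅       f = f tt
∑ ∙       f = f 0F + f 1F + f 2F
∑ (s ⊗ t) f = ∑ s λ a → ∑ t λ b → f (a , b)

∑-cong : ∀ s {f g} → (∀ a → f a ≡ g a) → ∑ s f ≡ ∑ s g
∑-cong ∅       f≗g = f≗g tt
∑-cong ∙       f≗g = cong₂ _+_ (cong₂ _+_ (f≗g 0F) (f≗g 1F)) (f≗g 2F)
∑-cong (s ⊗ t) f≗g = ∑-cong s λ a → ∑-cong t λ b → f≗g (a , b)

∑-zero : ∀ s {f} → (∀ a → f a ≡ 0ℤ) → ∑ s f ≡ 0ℤ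
∑-zero ∅       f≗0 = f≗0 tt
∑-zero ∙       f≗0 = cong₂ _+_ (cong₂ _+_ (f≗0 0F) (f≗0 1F)) (f≗0 2F)
∑-zero (s ⊗ t) f≗0 = ∑-zero s λ a → ∑-zero t λ b → f≗0 (a , b)

∑-distrib-+ : ∀ s f g → ∑ s (λ a → f a + g a) ≡ ∑ s f + ∑ s g
∑-distrib-+ ∅ f g = refl
∑-distrib-+ ∙ f g = regroup (f 0F) (f 1F) (f 2F) (g 0F) (g 1F) (g 2F)
  where
  regroup : ∀ x y z x′ y′ z′ → (x + x′) + (y + y′) + (z + z′) ≡ (x + y + z) + (x′ + y′ + z′)
  regroup = solve-∀
∑-distrib-+ (s ⊗ t) f g =
  trans (∑-cong s λ a → ∑-distrib-+ t _ _) (∑-distrib-+ s _ _)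

*-distribˡ-∑ : ∀ s c f → c · ∑ s f ≡ ∑ s (λ a → c · f a)
*-distribˡ-∑ ∅ c f = refl
*-distribˡ-∑ ∙ c f = expand c (f 0F) (f 1F) (f 2F)
  where
  expand : ∀ c x y z → c · (x + y + z) ≡ c · x + c · y + c · z
  expand = solve-∀
*-distribˡ-∑ (s ⊗ t) c f =
  trans (*-distribˡ-∑ s c _) (∑-cong s λ a → *-distribˡ-∑ t c _)

*-distribʳ-∑ : ∀ s c f → ∑ s f · c ≡ ∑ s (λ a → f a · c)
*-distribʳ-∑ s c f = trans (ℤ.*-comm (∑ s f) c)
  (trans (*-distribˡ-∑ s c f) (∑-cong s λ a → ℤ.*-comm c (f a)))

∑-*-∑ : ∀ s t f g → ∑ (s ⊗ t) (λ (a , b) → f a · g b) ≡ ∑ s f · ∑ t g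
∑-*-∑ s t f g = sym (trans (*-distribʳ-∑ s (∑ t g) f) (∑-cong s λ a → *-distribˡ-∑ t (f a) g))

∑-comm : ∀ s t (f : Exp s → Exp t → ℤ) → (∑ s λ a → ∑ t λ b → f a b) ≡ (∑ t λ b → ∑ s λ a → f a b)
∑-comm ∅ t f = refl
∑-comm ∙ t f = sym (trans (∑-distrib-+ t (λ b → f 0F b + f 1F b) (f 2F))
  (cong (_+ ∑ t (f 2F)) (∑-distrib-+ t (f 0F) (f 1F))))
∑-comm (s ⊗ s′) t f =
  trans (∑-cong s λ a → ∑-comm s′ t λ a′ → f (a , a′)) (∑-comm s t λ a b → ∑ s′ λ a′ → f (a , a′) b)

-- The source of all existence statements here: applied to a weighted sum over the choices of
-- colours, it picks the colours.
∑≢0⇒∃≢0 : ∀ s f → ∑ s f ≢ 0ℤ → ∃ λ a → f a ≢ 0ℤ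
∑≢0⇒∃≢0 ∅ f ≢0 = tt , ≢0
∑≢0⇒∃≢0 ∙ f ≢0 with f 0F ≟ 0ℤ | f 1F ≟ 0ℤ | f 2F ≟ 0ℤ
... | no p  | _     | _     = 0F , p
... | yes _ | no p  | _     = 1F , p
... | yes _ | yes _ | no p  = 2F , p
... | yes p | yes q | yes r = contradiction (cong₂ _+_ (cong₂ _+_ p q) r) ≢0
∑≢0⇒∃≢0 (s ⊗ t) f ≢0 with ∑≢0⇒∃≢0 s _ ≢0
... | a , ≢0′ with ∑≢0⇒∃≢0 t _ ≢0′
...   | b , ≢0″ = (a , b) , ≢0″

i*j≢0 : ∀ {i j} → i ≢ 0ℤ → j ≢ 0ℤ → i · j ≢ 0ℤ
i*j≢0 {i} i≢0 j≢0 = [ i≢0 , j≢0 ]′ ∘ ℤ.i*j≡0⇒i≡0∨j≡0 i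

i*j≢0⇒i≢0 : ∀ {i j} → i · j ≢ 0ℤ → i ≢ 0ℤ
i*j≢0⇒i≢0 ij≢0 refl = ij≢0 refl

i*j≢0⇒j≢0 : ∀ {i j} → i · j ≢ 0ℤ → j ≢ 0ℤ
i*j≢0⇒j≢0 {i} ij≢0 refl = ij≢0 (ℤ.*-zeroʳ i)

i≡0⇒i*j≡0 : ∀ {i} j → i ≡ 0ℤ → i · j ≡ 0ℤ
i≡0⇒i*j≡0 j refl = refl

j≡0⇒i*j≡0 : ∀ i {j} → j ≡ 0ℤ → i · j ≡ 0ℤ
j≡0⇒i*j≡0 i refl = ℤ.*-zeroʳ i

-- Divided differences on palettes of three colours

Palette : Set
Palette = ∃ λ (f : Fin 3 → ℕ) → Injective _≡_ _≡_ f

-- `Exp s` serves a second time, now for positions in the palettes, so that `∑` also runs over all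
-- choices of colours.
choose : ∀ s → Tree Palette s → Exp s → Tree ℕ s
choose ∅       _       _       = tt
choose ∙       (f , _) i       = f i
choose (s ⊗ t) (L , M) (i , j) = choose s L i , choose t M j

-- The second divided difference of x^(a+b) when a + b ≤ 2. For a + b > 2, where that difference
-- depends on the list, the value is set to 0.
δ : Fin 3 → Fin 3 → ℤ
δ 0F 2F = 1ℤ
δ 1F 1F = 1ℤ
δ 2F 0F = 1ℤ
δ _  _  = 0ℤ

Δ : ∀ s → Exp s → Exp s → ℤ
Δ ∅       _       _         = 1ℤ
Δ ∙       a       b         = δ a b
Δ (s ⊗ t) (a , b) (a′ , b′) = Δ s a a′ · Δ t b b′

complement : ∀ s → Exp s → Exp s
complement ∅       _       = tt
complement ∙       a       = opposite a
complement (s ⊗ t) (a , b) = complement s a , complement t b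

∑-Δ : ∀ s b (f : Exp s → ℤ) → ∑ s (λ c → f c · Δ s b c) ≡ f (complement s b)
∑-Δ ∅ b f = ℤ.*-identityʳ (f tt)
∑-Δ ∙ 0F f = pick (f 0F) (f 1F) (f 2F)
  where
  pick : ∀ x y z → x · 0ℤ + y · 0ℤ + z · 1ℤ ≡ z
  pick = solve-∀
∑-Δ ∙ 1F f = pick (f 0F) (f 1F) (f 2F)
  where
  pick : ∀ x y z → x · 0ℤ + y · 1ℤ + z · 0ℤ ≡ y
  pick = solve-∀
∑-Δ ∙ 2F f = pick (f 0F) (f 1F) (f 2F)
  where
  pick : ∀ x y z → x · 1ℤ + y · 0ℤ + z · 0ℤ ≡ x
  pick = solve-∀
∑-Δ (s ⊗ t) (b , b′) f = trans
  (∑-cong s λ c → trans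
    (∑-cong t λ c′ → rearrange (f (c , c′)) (Δ s b c) (Δ t b′ c′))
    (trans (sym (*-distribʳ-∑ t (Δ s b c) (λ c′ → f (c , c′) · Δ t b′ c′)))
           (cong (_· Δ s b c) (∑-Δ t b′ λ c′ → f (c , c′)))))
  (∑-Δ s b λ c → f (c , complement t b′))
  where
  rearrange : ∀ x y z → x · (y · z) ≡ (x · z) · y
  rearrange = solve-∀

twice : ℕ → ℕ
twice n = n ℕ.+ n

deg-complement : ∀ s b → deg s b ℕ.+ deg s (complement s b) ≡ twice (size s)
deg-complement ∅ b = refl
deg-complement ∙ 0F = refl
deg-complement ∙ 1F = refl
deg-complement ∙ 2F = refl
deg-complement (s ⊗ t) (b , b′) = trans
  (+-interchange (deg s b) (deg t b′) _ _)
  (trans (cong₂ ℕ._+_ (deg-complement s b) (deg-complement t b′))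
         (+-interchange (size s) (size s) (size t) (size t)))

m+n<k+l⇒m<k⊎n<l : ∀ {m n k l} → m ℕ.+ n < k ℕ.+ l → m < k ⊎ n < l
m+n<k+l⇒m<k⊎n<l {m} {n} {k} {l} lt with m ℕ.<? k | n ℕ.<? l
... | yes p | _     = inj₁ p
... | no _  | yes q = inj₂ q
... | no p  | no q  =
  contradiction (ℕ.<-≤-trans lt (ℕ.+-mono-≤ (ℕ.≮⇒≥ p) (ℕ.≮⇒≥ q))) (ℕ.<-irrefl refl)

-- `Δ` lives on exponents that sum to 2 at every leaf; a defect in the total degree shows at some
-- leaf. Likewise for an excess in `Δ-high`.
Δ-low : ∀ s b c → deg s b ℕ.+ deg s c < twice (size s) → Δ s b c ≡ 0ℤ
Δ-low ∅ b c ()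
Δ-low ∙ 0F 0F _ = refl
Δ-low ∙ 0F 1F _ = refl
Δ-low ∙ 0F 2F (s≤s (s≤s ()))
Δ-low ∙ 1F 0F _ = refl
Δ-low ∙ 1F 1F (s≤s (s≤s ()))
Δ-low ∙ 1F 2F (s≤s (s≤s ()))
Δ-low ∙ 2F c (s≤s (s≤s ()))
Δ-low (s ⊗ t) (b , b′) (c , c′) lt with m+n<k+l⇒m<k⊎n<l
  (subst₂ _<_ (+-interchange (deg s b) _ _ _) (+-interchange (size s) _ _ _) lt)
... | inj₁ p = i≡0⇒i*j≡0 (Δ t b′ c′) (Δ-low s b c p)
... | inj₂ p = j≡0⇒i*j≡0 (Δ s b c) (Δ-low t b′ c′ p)

Δ-high : ∀ s b c → twice (size s) < deg s b ℕ.+ deg s c → Δ s b c ≡ 0ℤ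
Δ-high ∅ b c ()
Δ-high ∙ 0F 0F ()
Δ-high ∙ 0F 1F (s≤s ())
Δ-high ∙ 0F 2F (s≤s (s≤s ()))
Δ-high ∙ 1F 0F (s≤s ())
Δ-high ∙ 1F 1F (s≤s (s≤s ()))
Δ-high ∙ 1F 2F _ = refl
Δ-high ∙ 2F 0F (s≤s (s≤s ()))
Δ-high ∙ 2F 1F _ = refl
Δ-high ∙ 2F 2F _ = refl
Δ-high (s ⊗ t) (b , b′) (c , c′) lt with m+n<k+l⇒m<k⊎n<l
  (subst₂ _<_ (+-interchange (size s) _ _ _) (+-interchange (deg s b) _ _ _) lt)
... | inj₁ p = i≡0⇒i*j≡0 (Δ t b′ c′) (Δ-high s b c p)
... | inj₂ p = j≡0⇒i*j≡0 (Δ s b c) (Δ-high t b′ c′ p)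

-- The weights of the second divided difference at the three colours of a palette, times disc.
weight : ∀ s → Tree Palette s → Exp s → ℤ
weight ∅       _       _       = 1ℤ
weight ∙       (f , _) 0F      = + f 2F - + f 1F
weight ∙       (f , _) 1F      = + f 0F - + f 2F
weight ∙       (f , _) 2F      = + f 1F - + f 0F
weight (s ⊗ t) (L , M) (i , j) = weight s L i · weight t M j

-- The product of the Vandermonde determinants of the palettes. It is the denominator of the divided
-- differences; clearing it keeps all values integral.
disc : ∀ s → Tree Palette s → ℤ
disc ∅       _       = 1ℤ
disc ∙       (f , _) = (+ f 1F - + f 0F) · ((+ f 2F - + f 0F) · (+ f 2F - + f 1F))
disc (s ⊗ t) (L , M) = disc s L · disc t M

disc≢0 : ∀ s L → disc s L ≢ 0ℤ
disc≢0 ∅ _ ()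
disc≢0 ∙ (f , inj) = i*j≢0 (diff (λ ())) (i*j≢0 (diff (λ ())) (diff (λ ())))
  where
  diff : ∀ {i j} → i ≢ j → + f i - + f j ≢ 0ℤ
  diff i≢j eq = i≢j (inj (ℤ.+-injective (ℤ.i-j≡0⇒i≡j _ _ eq)))
disc≢0 (s ⊗ t) (L , M) = i*j≢0 (disc≢0 s L) (disc≢0 t M)

-- The scaled divided difference of the product of two monomials, one from each end of the edges,
-- once both ends carry the same variable.
moment : ∀ s → Tree Palette s → Exp s → Exp s → ℤ
moment s L b c = ∑ s λ i → weight s L i · (mon s (choose s L i) b · mon s (choose s L i) c)

moment-leaf : ∀ L a b → deg ∙ a ℕ.+ deg ∙ b ≤ 2 → moment ∙ L a b ≡ disc ∙ L · δ a b
moment-leaf (f , _) a b ≤2 = go a b ≤2 (+ f 0F) (+ f 1F) (+ f 2F)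
  where
  go : ∀ a b → toℕ a ℕ.+ toℕ b ≤ 2 → ∀ x y z →
    (z - y) · (x ^ toℕ a · x ^ toℕ b) + (x - z) · (y ^ toℕ a · y ^ toℕ b)
      + (y - x) · (z ^ toℕ a · z ^ toℕ b)
    ≡ (y - x) · ((z - x) · (z - y)) · δ a b
  go 0F 0F _ = lemma
    where
    lemma : ∀ x y z → (z - y) · (1ℤ · 1ℤ) + (x - z) · (1ℤ · 1ℤ) + (y - x) · (1ℤ · 1ℤ)
      ≡ (y - x) · ((z - x) · (z - y)) · 0ℤ
    lemma = solve-∀
  go 0F 1F _ = lemma
    where
    lemma : ∀ x y z → (z - y) · (1ℤ · (x · 1ℤ)) + (x - z) · (1ℤ · (y · 1ℤ)) + (y - x) · (1ℤ · (z · 1ℤ))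
      ≡ (y - x) · ((z - x) · (z - y)) · 0ℤ
    lemma = solve-∀
  go 1F 0F _ = lemma
    where
    lemma : ∀ x y z → (z - y) · ((x · 1ℤ) · 1ℤ) + (x - z) · ((y · 1ℤ) · 1ℤ) + (y - x) · ((z · 1ℤ) · 1ℤ)
      ≡ (y - x) · ((z - x) · (z - y)) · 0ℤ
    lemma = solve-∀
  go 1F 1F _ = lemma
    where
    lemma : ∀ x y z → (z - y) · ((x · 1ℤ) · (x · 1ℤ)) + (x - z) · ((y · 1ℤ) · (y · 1ℤ))
        + (y - x) · ((z · 1ℤ) · (z · 1ℤ))
      ≡ (y - x) · ((z - x) · (z - y)) · 1ℤ
    lemma = solve-∀
  go 0F 2F _ = lemma
    where
    lemma : ∀ x y z → (z - y) · (1ℤ · (x · (x · 1ℤ))) + (x - z) · (1ℤ · (y · (y · 1ℤ)))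
        + (y - x) · (1ℤ · (z · (z · 1ℤ)))
      ≡ (y - x) · ((z - x) · (z - y)) · 1ℤ
    lemma = solve-∀
  go 2F 0F _ = lemma
    where
    lemma : ∀ x y z → (z - y) · ((x · (x · 1ℤ)) · 1ℤ) + (x - z) · ((y · (y · 1ℤ)) · 1ℤ)
        + (y - x) · ((z · (z · 1ℤ)) · 1ℤ)
      ≡ (y - x) · ((z - x) · (z - y)) · 1ℤ
    lemma = solve-∀
  go 1F 2F (s≤s (s≤s ()))
  go 2F 1F (s≤s (s≤s ()))
  go 2F 2F (s≤s (s≤s ()))

moment-⊗ : ∀ s t L M b b′ c c′ →
  moment (s ⊗ t) (L , M) (b , b′) (c , c′) ≡ moment s L b c · moment t M b′ c′
moment-⊗ s t L M b b′ c c′ = trans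
  (∑-cong (s ⊗ t) λ (i , j) → trans
    (cong (weight s L i · weight t M j ·_)
      (*-interchange (mon s (choose s L i) b) (mon t (choose t M j) b′) _ _))
    (*-interchange (weight s L i) _ _ _))
  (∑-*-∑ s t _ _)

moment-low : ∀ s L b c → deg s b ℕ.+ deg s c ≤ twice (size s) → moment s L b c ≡ disc s L · Δ s b c
moment-low ∅ L b c _ = refl
moment-low ∙ L b c ≤2 = moment-leaf L b c ≤2
moment-low (s ⊗ t) (L , M) (b , b′) (c , c′) ≤n =
  trans (moment-⊗ s t L M b b′ c c′)
    (trans split (sym (*-interchange (disc s L) (disc t M) (Δ s b c) (Δ t b′ c′))))
  where
  Goal : Set
  Goal = moment s L b c · moment t M b′ c′ ≡ (disc s L · Δ s b c) · (disc t M · Δ t b′ c′)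

  ≤n′ : (deg s b ℕ.+ deg s c) ℕ.+ (deg t b′ ℕ.+ deg t c′) ≤ twice (size s) ℕ.+ twice (size t)
  ≤n′ = subst₂ _≤_ (+-interchange (deg s b) _ _ _) (+-interchange (size s) _ _ _) ≤n

  -- An excess of degree in one factor forces a defect in the other, where both sides vanish.
  low-left : twice (size t) < deg t b′ ℕ.+ deg t c′ → Goal
  low-left high = trans
    (i≡0⇒i*j≡0 _ (trans (moment-low s L b c (ℕ.<⇒≤ defect)) vanish))
    (sym (i≡0⇒i*j≡0 _ vanish))
    where
    defect : deg s b ℕ.+ deg s c < twice (size s)
    defect = ℕ.+-cancelʳ-< (twice (size t)) _ _ (ℕ.<-≤-trans (ℕ.+-monoʳ-< (deg s b ℕ.+ deg s c) high) ≤n′)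
    vanish : disc s L · Δ s b c ≡ 0ℤ
    vanish = j≡0⇒i*j≡0 (disc s L) (Δ-low s b c defect)

  low-right : twice (size s) < deg s b ℕ.+ deg s c → Goal
  low-right high = trans
    (j≡0⇒i*j≡0 (moment s L b c) (trans (moment-low t M b′ c′ (ℕ.<⇒≤ defect)) vanish))
    (sym (j≡0⇒i*j≡0 (disc s L · Δ s b c) vanish))
    where
    defect : deg t b′ ℕ.+ deg t c′ < twice (size t)
    defect = ℕ.+-cancelˡ-< (twice (size s)) _ _ (ℕ.<-≤-trans (ℕ.+-monoˡ-< (deg t b′ ℕ.+ deg t c′) high) ≤n′)
    vanish : disc t M · Δ t b′ c′ ≡ 0ℤ
    vanish = j≡0⇒i*j≡0 (disc t M) (Δ-low t b′ c′ defect)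

  split : Goal
  split with deg s b ℕ.+ deg s c ℕ.≤? twice (size s) | deg t b′ ℕ.+ deg t c′ ℕ.≤? twice (size t)
  ... | no p  | _     = low-right (ℕ.≰⇒> p)
  ... | yes _ | no q  = low-left (ℕ.≰⇒> q)
  ... | yes p | yes q = cong₂ _·_ (moment-low s L b c p) (moment-low t M b′ c′ q)

-- Polynomials that certify colourings: products and contractions

eval : ∀ s → (Exp s → ℤ) → Tree ℕ s → ℤ
eval s q ξ = ∑ s λ a → q a · mon s ξ a

-- A polynomial that depends on the lists, but whose part of degree d is a nonzero multiple of a
-- tensor t that does not, and which has no terms of higher degree; P holds where it does not vanish.
record Rep (s : Shape) (d : ℕ) (t : Exp s → ℤ) (P : Tree ℕ s → Set) : Set where
  field
    coeff   : Exp s → ℤ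
    scale   : ℤ
    scale≢0 : scale ≢ 0ℤ
    top     : ∀ a → d ≤ deg s a → coeff a ≡ scale · t a
    bound   : ∀ a → d < deg s a → t a ≡ 0ℤ
    sound   : ∀ ξ → eval s coeff ξ ≢ 0ℤ → P ξ

  coeff≡0 : ∀ a → d < deg s a → coeff a ≡ 0ℤ
  coeff≡0 a d< = trans (top a (ℕ.<⇒≤ d<)) (j≡0⇒i*j≡0 scale (bound a d<))

open Rep

weaken : ∀ {s d t P Q} → (∀ ξ → P ξ → Q ξ) → Rep s d t P → Rep s d t Q
weaken P⇒Q R = record
  { coeff   = coeff R
  ; scale   = scale R
  ; scale≢0 = scale≢0 R
  ; top     = top R
  ; bound   = bound R
  ; sound   = λ ξ ≢0 → P⇒Q ξ (sound R ξ ≢0)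
  }

infixr 5 _⊠_

-- Leading parts multiply: in total degree at least d + d′, if one factor is below its degree then
-- the other is above its own, where coefficient and tensor both vanish.
_⊠_ : ∀ {s s′ d d′ t t′ P P′} → Rep s d t P → Rep s′ d′ t′ P′ →
  Rep (s ⊗ s′) (d ℕ.+ d′) (λ (a , b) → t a · t′ b) (λ (ξ , η) → P ξ × P′ η)
_⊠_ {s} {s′} {d} {d′} {t} {t′} R R′ = record
  { coeff   = λ (a , b) → coeff R a · coeff R′ b
  ; scale   = scale R · scale R′
  ; scale≢0 = i*j≢0 (scale≢0 R) (scale≢0 R′)
  ; top     = λ (a , b) → product-top a b
  ; bound   = λ (a , b) d< →
      [ (λ p → i≡0⇒i*j≡0 (t′ b) (bound R a p)) , (λ p → j≡0⇒i*j≡0 (t a) (bound R′ b p)) ]′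
        (m+n<k+l⇒m<k⊎n<l d<)
  ; sound   = λ (ξ , η) ≢0 →
      let ≢0′ = ≢0 ∘ trans (factor ξ η)
      in sound R ξ (i*j≢0⇒i≢0 ≢0′) , sound R′ η (i*j≢0⇒j≢0 {eval s (coeff R) ξ} ≢0′)
  }
  where
  product-top : ∀ a b → d ℕ.+ d′ ≤ deg s a ℕ.+ deg s′ b →
    coeff R a · coeff R′ b ≡ (scale R · scale R′) · (t a · t′ b)
  product-top a b d≤ with d ℕ.≤? deg s a | d′ ℕ.≤? deg s′ b
  ... | yes p | yes q = trans (cong₂ _·_ (top R a p) (top R′ b q))
    (*-interchange (scale R) (t a) (scale R′) (t′ b))
  ... | no p  | _     = trans (j≡0⇒i*j≡0 (coeff R a) (coeff≡0 R′ b high))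
    (sym (j≡0⇒i*j≡0 (scale R · scale R′) (j≡0⇒i*j≡0 (t a) (bound R′ b high))))
    where
    high : d′ < deg s′ b
    high = ℕ.+-cancelˡ-< d _ _ (ℕ.≤-<-trans d≤ (ℕ.+-monoˡ-< (deg s′ b) (ℕ.≰⇒> p)))
  ... | yes _ | no q  = trans (i≡0⇒i*j≡0 (coeff R′ b) (coeff≡0 R a high))
    (sym (j≡0⇒i*j≡0 (scale R · scale R′) (i≡0⇒i*j≡0 (t′ b) (bound R a high))))
    where
    high : d < deg s a
    high = ℕ.+-cancelʳ-< d′ _ _ (ℕ.≤-<-trans d≤ (ℕ.+-monoʳ-< (deg s a) (ℕ.≰⇒> q)))

  factor : ∀ ξ η → eval (s ⊗ s′) (λ (a , b) → coeff R a · coeff R′ b) (ξ , η)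
    ≡ eval s (coeff R) ξ · eval s′ (coeff R′) η
  factor ξ η = trans
    (∑-cong (s ⊗ s′) λ (a , b) →
      *-interchange (coeff R a) (coeff R′ b) (mon s ξ a) (mon s′ η b))
    (∑-*-∑ s s′ (λ a → coeff R a · mon s ξ a) (λ b → coeff R′ b · mon s′ η b))

infix 4 _∈ₚ_
_∈ₚ_ : ∀ {s} → Tree ℕ s → Tree Palette s → Set
_∈ₚ_ {∅}     _       _       = ⊤
_∈ₚ_ {∙}     x       (f , _) = ∃ λ i → x ≡ f i
_∈ₚ_ {s ⊗ t} (x , y) (L , M) = _∈ₚ_ {s} x L × _∈ₚ_ {t} y M

choose∈ₚ : ∀ s L i → _∈ₚ_ {s} (choose s L i) L
choose∈ₚ ∅       _       _       = tt
choose∈ₚ ∙       _       i       = i , refl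
choose∈ₚ (s ⊗ t) (L , M) (i , j) = choose∈ₚ s L i , choose∈ₚ t M j

-- In degree at least d + 2 |w| the pairing Δ sees only complementary exponents: if the ends to be
-- joined have smaller total degree both sides vanish, and if larger the coefficient does.
contract : ∀ {s d} w {t P} → Rep (s ⊗ (w ⊗ w)) (d ℕ.+ twice (size w)) t P → (L : Tree Palette w) →
  Rep s d (λ a → ∑ w λ b → t (a , (b , complement w b)))
          (λ ξ → ∃ λ c → _∈ₚ_ {w} c L × P (ξ , (c , c)))
contract {s} {d} w {t} {P} R L = record
  { coeff   = coeff′
  ; scale   = scale R · disc w L
  ; scale≢0 = i*j≢0 (scale≢0 R) (disc≢0 w L)
  ; top     = contract-top
  ; bound   = λ a d< → ∑-zero w λ b →
      bound R (a , (b , complement w b))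
        (subst (λ n → d ℕ.+ n₂ < deg s a ℕ.+ n) (sym (deg-complement w b)) (ℕ.+-monoˡ-< n₂ d<))
  ; sound   = contract-sound
  }
  where
  n₂ : ℕ
  n₂ = twice (size w)

  coeff′ : Exp s → ℤ
  coeff′ a = ∑ (w ⊗ w) λ (b , c) → coeff R (a , (b , c)) · moment w L b c

  module _ (a : Exp s) (d≤ : d ≤ deg s a) (b c : Exp w) where
    q e : ℤ
    q = coeff R (a , (b , c))
    e = t (a , (b , c))

    vanish : (q ≡ 0ℤ × e ≡ 0ℤ) ⊎ (moment w L b c ≡ 0ℤ × Δ w b c ≡ 0ℤ) →
      q · moment w L b c ≡ (scale R · disc w L) · (e · Δ w b c)
    vanish (inj₁ (p , p′)) = trans (i≡0⇒i*j≡0 _ p)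
      (sym (j≡0⇒i*j≡0 (scale R · disc w L) (i≡0⇒i*j≡0 (Δ w b c) p′)))
    vanish (inj₂ (p , p′)) = trans (j≡0⇒i*j≡0 q p)
      (sym (j≡0⇒i*j≡0 (scale R · disc w L) (j≡0⇒i*j≡0 e p′)))

    contract-term : q · moment w L b c ≡ (scale R · disc w L) · (e · Δ w b c)
    contract-term with ℕ.<-cmp (deg w b ℕ.+ deg w c) n₂
    ... | tri< p _ _ = vanish (inj₂
      ( trans (moment-low w L b c (ℕ.<⇒≤ p)) (j≡0⇒i*j≡0 (disc w L) (Δ-low w b c p))
      , Δ-low w b c p))
    ... | tri≈ _ p _ = trans
      (cong₂ _·_ (top R (a , (b , c)) (ℕ.+-mono-≤ d≤ (ℕ.≤-reflexive (sym p))))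
                 (moment-low w L b c (ℕ.≤-reflexive p)))
      (*-interchange (scale R) e (disc w L) (Δ w b c))
    ... | tri> _ _ p = vanish (inj₁ (coeff≡0 R _ high , bound R _ high))
      where
      high : d ℕ.+ n₂ < deg s a ℕ.+ (deg w b ℕ.+ deg w c)
      high = ℕ.+-mono-≤-< d≤ p

  contract-top : ∀ a → d ≤ deg s a →
    coeff′ a ≡ (scale R · disc w L) · ∑ w (λ b → t (a , (b , complement w b)))
  contract-top a d≤ = trans (∑-cong (w ⊗ w) λ (b , c) → contract-term a d≤ b c)
    (trans (sym (*-distribˡ-∑ (w ⊗ w) (scale R · disc w L) λ (b , c) → t (a , (b , c)) · Δ w b c))
           (cong (scale R · disc w L ·_) (∑-cong w λ b → ∑-Δ w b λ c → t (a , (b , c)))))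

  diagonal : Tree ℕ s → Exp w → Tree ℕ (s ⊗ (w ⊗ w))
  diagonal ξ i = ξ , (choose w L i , choose w L i)

  -- Unfolding the moments turns the contraction into a weighted sum over the colours of the
  -- palettes, with the same colour at both ends of each joined edge.
  spread : ∀ ξ → eval s coeff′ ξ ≡ ∑ w λ i → weight w L i · eval (s ⊗ (w ⊗ w)) (coeff R) (diagonal ξ i)
  spread ξ = begin
    (∑ s λ a → coeff′ a · mon s ξ a)
      ≡⟨ ∑-cong s (λ a → trans
           (*-distribʳ-∑ (w ⊗ w) (mon s ξ a) λ (b , c) → coeff R (a , (b , c)) · moment w L b c)
           (∑-cong (w ⊗ w) λ (b , c) → expand a b c)) ⟩
    (∑ (s ⊗ (w ⊗ w)) λ e → ∑ w λ i → summand i e)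
      ≡⟨ ∑-comm (s ⊗ (w ⊗ w)) w (λ e i → summand i e) ⟩
    (∑ w λ i → ∑ (s ⊗ (w ⊗ w)) (summand i))
      ≡⟨ ∑-cong w (λ i → sym (*-distribˡ-∑ (s ⊗ (w ⊗ w)) (weight w L i)
           λ e → coeff R e · mon (s ⊗ (w ⊗ w)) (diagonal ξ i) e)) ⟩
    (∑ w λ i → weight w L i · eval (s ⊗ (w ⊗ w)) (coeff R) (diagonal ξ i)) ∎
    where
    open ≡-Reasoning
    summand : Exp w → Exp (s ⊗ (w ⊗ w)) → ℤ
    summand i e = weight w L i · (coeff R e · mon (s ⊗ (w ⊗ w)) (diagonal ξ i) e)

    rearrange : ∀ q m x y → (q · (x · y)) · m ≡ x · (q · (m · y))
    rearrange = solve-∀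

    expand : ∀ a b c → (coeff R (a , (b , c)) · moment w L b c) · mon s ξ a
      ≡ ∑ w λ i → summand i (a , (b , c))
    expand a b c = trans
      (cong (_· mon s ξ a) (*-distribˡ-∑ w (coeff R (a , (b , c)))
        λ i → weight w L i · (mon w (choose w L i) b · mon w (choose w L i) c)))
      (trans
        (*-distribʳ-∑ w (mon s ξ a) λ i → coeff R (a , (b , c)) ·
          (weight w L i · (mon w (choose w L i) b · mon w (choose w L i) c)))
        (∑-cong w λ i → rearrange (coeff R (a , (b , c))) (mon s ξ a) (weight w L i) _))

  contract-sound : ∀ ξ → eval s coeff′ ξ ≢ 0ℤ → ∃ λ c → _∈ₚ_ {w} c L × P (ξ , (c , c))
  contract-sound ξ ≢0 with ∑≢0⇒∃≢0 w _ (≢0 ∘ trans (spread ξ))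
  ... | i , ≢0′ = choose w L i , choose∈ₚ w L i ,
    sound R (diagonal ξ i) (i*j≢0⇒j≢0 {weight w L i} ≢0′)

-- Relabelling the ends

-- A natural bijection of leaves: the same relabelling acts on exponents and on colours.
record Iso (s s′ : Shape) : Set₁ where
  field
    to    : ∀ {A} → Tree A s → Tree A s′
    ∑-to  : ∀ f → ∑ s (λ a → f (to a)) ≡ ∑ s′ f
    deg-to : ∀ a → deg s′ (to a) ≡ deg s a
    mon-to : ∀ ξ a → mon s′ (to ξ) (to a) ≡ mon s ξ a

open Iso

relabel : ∀ {s s′ d t P} (I : Iso s s′) → Rep s′ d t P → Rep s d (λ a → t (to I a)) (λ ξ → P (to I ξ))
relabel {s} {s′} {d} I R = record
  { coeff   = λ a → coeff R (to I a)
  ; scale   = scale R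
  ; scale≢0 = scale≢0 R
  ; top     = λ a d≤ → top R (to I a) (subst (d ≤_) (sym (deg-to I a)) d≤)
  ; bound   = λ a d< → bound R (to I a) (subst (d <_) (sym (deg-to I a)) d<)
  ; sound   = λ ξ ≢0 → sound R (to I ξ) (≢0 ∘ trans (trans
      (∑-cong s λ a → cong (coeff R (to I a) ·_) (sym (mon-to I ξ a)))
      (∑-to I λ b → coeff R b · mon s′ (to I ξ) b)))
  }

idᴵ : ∀ {s} → Iso s s
idᴵ = record { to = id ; ∑-to = λ f → refl ; deg-to = λ a → refl ; mon-to = λ ξ a → refl }

infixr 9 _⨾_
_⨾_ : ∀ {s s′ s″} → Iso s s′ → Iso s′ s″ → Iso s s″
I ⨾ K = record
  { to     = λ x → to K (to I x)
  ; ∑-to   = λ f → trans (∑-to I (λ b → f (to K b))) (∑-to K f)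
  ; deg-to = λ a → trans (deg-to K (to I a)) (deg-to I a)
  ; mon-to = λ ξ a → trans (mon-to K (to I ξ) (to I a)) (mon-to I ξ a)
  }

infixr 10 _⊗ᴵ_
_⊗ᴵ_ : ∀ {s s′ t t′} → Iso s s′ → Iso t t′ → Iso (s ⊗ t) (s′ ⊗ t′)
_⊗ᴵ_ {s} {s′} {t} {t′} I K = record
  { to     = λ (x , y) → to I x , to K y
  ; ∑-to   = λ f → trans (∑-cong s λ a → ∑-to K λ b → f (to I a , b))
                         (∑-to I λ a → ∑ t′ λ b → f (a , b))
  ; deg-to = λ (a , b) → cong₂ ℕ._+_ (deg-to I a) (deg-to K b)
  ; mon-to = λ (ξ , η) (a , b) → cong₂ _·_ (mon-to I ξ a) (mon-to K η b)
  }

swapᴵ : ∀ {s t} → Iso (s ⊗ t) (t ⊗ s)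
swapᴵ {s} {t} = record
  { to     = λ (x , y) → y , x
  ; ∑-to   = λ f → ∑-comm s t λ a b → f (b , a)
  ; deg-to = λ (a , b) → ℕ.+-comm (deg t b) (deg s a)
  ; mon-to = λ (ξ , η) (a , b) → ℤ.*-comm (mon t η b) (mon s ξ a)
  }

assocᴵ : ∀ {s t r} → Iso (s ⊗ (t ⊗ r)) ((s ⊗ t) ⊗ r)
assocᴵ {s} {t} {r} = record
  { to     = λ (x , (y , z)) → (x , y) , z
  ; ∑-to   = λ f → refl
  ; deg-to = λ (a , (b , c)) → ℕ.+-assoc (deg s a) (deg t b) (deg r c)
  ; mon-to = λ (ξ , (η , ζ)) (a , (b , c)) → ℤ.*-assoc (mon s ξ a) (mon t η b) (mon r ζ c)
  }

unitᴵ : ∀ {s} → Iso (∅ ⊗ s) s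
unitᴵ {s} = record
  { to     = proj₂
  ; ∑-to   = λ f → refl
  ; deg-to = λ a → refl
  ; mon-to = λ (_ , ξ) (_ , a) → sym (ℤ.*-identityˡ (mon s ξ a))
  }

interchangeᴵ : ∀ {s t s′ t′} → Iso ((s ⊗ t) ⊗ (s′ ⊗ t′)) ((s ⊗ s′) ⊗ (t ⊗ t′))
interchangeᴵ {s} {t} {s′} {t′} = record
  { to     = λ ((x , y) , (z , w)) → (x , z) , (y , w)
  ; ∑-to   = λ f → ∑-cong s λ a → ∑-comm t s′ λ b c → ∑ t′ λ d → f ((a , c) , (b , d))
  ; deg-to = λ ((a , b) , (c , d)) → +-interchange (deg s a) (deg s′ c) (deg t b) (deg t′ d)
  ; mon-to = λ ((ξ , η) , (ζ , θ)) ((a , b) , (c , d)) →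
      *-interchange (mon s ξ a) (mon s′ ζ c) (mon t η b) (mon t′ θ d)
  }

-- The polynomial of a vertex

-- The Levi-Civita symbol: the coefficients of the 3 × 3 Vandermonde determinant.
ε : Fin 3 → Fin 3 → Fin 3 → ℤ
ε 0F 1F 2F = 1ℤ
ε 1F 2F 0F = 1ℤ
ε 2F 0F 1F = 1ℤ
ε 0F 2F 1F = -1ℤ
ε 2F 1F 0F = -1ℤ
ε 1F 0F 2F = -1ℤ
ε _  _  _  = 0ℤ

Distinct : ℕ → ℕ → ℕ → Set
Distinct x y z = x ≢ y × x ≢ z × y ≢ z

-- The polynomial of a vertex is the Vandermonde determinant of the colours of its three edges.
vertex : Rep ((∙ ⊗ ∙) ⊗ ∙) 3 (λ ((a , b) , c) → ε a b c) (λ ((x , y) , z) → Distinct x y z)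
vertex = record
  { coeff   = ε′
  ; scale   = 1ℤ
  ; scale≢0 = λ ()
  ; top     = λ a _ → sym (ℤ.*-identityˡ (ε′ a))
  ; bound   = λ ((a , b) , c) → bound′ a b c
  ; sound   = λ ((x , y) , z) ≢0 →
      let ≢0′ = λ eq → ≢0 (trans (vandermonde (+ x) (+ y) (+ z)) eq)
          yx≢0 = i*j≢0⇒i≢0 ≢0′
          rest = i*j≢0⇒j≢0 {+ y - + x} ≢0′
      in (λ eq → yx≢0 (self y x (sym eq)))
       , (λ eq → i*j≢0⇒i≢0 rest (self z x (sym eq)))
       , (λ eq → i*j≢0⇒j≢0 {+ z - + x} rest (self z y (sym eq)))
  }
  where
  ε′ : Exp ((∙ ⊗ ∙) ⊗ ∙) → ℤ
  ε′ ((a , b) , c) = ε a b c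

  self : ∀ m n → m ≡ n → + m - + n ≡ 0ℤ
  self m n eq = ℤ.i≡j⇒i-j≡0 (cong +_ eq)

  bound′ : ∀ a b c → 3 < toℕ a ℕ.+ toℕ b ℕ.+ toℕ c → ε a b c ≡ 0ℤ
  bound′ = toWitness {a? = all? λ a → all? λ b → all? λ c →
    (3 ℕ.<? toℕ a ℕ.+ toℕ b ℕ.+ toℕ c) →-dec (ε a b c ≟ 0ℤ)} tt

  vandermonde : ∀ x y z → (∑ ((∙ ⊗ ∙) ⊗ ∙) λ ((a , b) , c) → ε a b c · (x ^ toℕ a · y ^ toℕ b · z ^ toℕ c))
    ≡ (y - x) · ((z - x) · (z - y))
  -- The expression is assembled by the same threefold sum as `∑`, so the 27 terms need not be
  -- written out.
  vandermonde = solve 3 (λ x y z →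
      (∑ᴾ λ a → ∑ᴾ λ b → ∑ᴾ λ c → Κ (ε a b c) ⊛ (x ^ᴾ a ⊛ y ^ᴾ b ⊛ z ^ᴾ c))
      ⊜ (y ⊞ ⊝ x) ⊛ ((z ⊞ ⊝ x) ⊛ (z ⊞ ⊝ y))) refl
    where
    open NonReflective ring using (Expr; Κ; ⊝_; solve; _⊜_)
      renaming (_⊕_ to infixl 6 _⊞_; _⊗_ to infixl 7 _⊛_)
    ∑ᴾ : (Fin 3 → Expr ℤ 3) → Expr ℤ 3
    ∑ᴾ p = p 0F ⊞ p 1F ⊞ p 2F
    infixl 8 _^ᴾ_
    _^ᴾ_ : Expr ℤ 3 → Fin 3 → Expr ℤ 3
    x ^ᴾ 0F = Κ 1ℤ
    x ^ᴾ 1F = x ⊛ Κ 1ℤ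
    x ^ᴾ 2F = x ⊛ (x ⊛ Κ 1ℤ)

-- Tables, matrices and twisted traces

∀-dec : ∀ s {P : Exp s → Set} → (∀ a → Dec (P a)) → Dec (∀ a → P a)
∀-dec ∅       P? = map′ (λ p _ → p) (λ p → p tt) (P? tt)
∀-dec ∙       P? = all? P?
∀-dec (s ⊗ t) P? = map′ (λ p (a , b) → p a b) (λ p a b → p (a , b)) (∀-dec s λ a → ∀-dec t λ b → P? (a , b))

-- Functions on `Exp s` as nested triples, so that computed entries can be shared between lookups.
Table : Shape → Set → Set
Table ∅       A = A
Table ∙       A = A × A × A
Table (s ⊗ t) A = Table s (Table t A)

tabulate : ∀ s {A} → (Exp s → A) → Table s A
tabulate ∅       f = f tt
tabulate ∙       f = f 0F , f 1F , f 2F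
tabulate (s ⊗ t) f = tabulate s λ a → tabulate t λ b → f (a , b)

lookup : ∀ s {A} → Table s A → Exp s → A
lookup ∅       x           _  = x
lookup ∙       (x , _ , _) 0F = x
lookup ∙       (_ , y , _) 1F = y
lookup ∙       (_ , _ , z) 2F = z
lookup (s ⊗ t) T           (a , b) = lookup t (lookup s T a) b

lookup∘tabulate : ∀ s {A} (f : Exp s → A) a → lookup s (tabulate s f) a ≡ f a
lookup∘tabulate ∅       f a  = refl
lookup∘tabulate ∙       f 0F = refl
lookup∘tabulate ∙       f 1F = refl
lookup∘tabulate ∙       f 2F = refl
lookup∘tabulate (s ⊗ t) f (a , b) = trans
  (cong (λ T → lookup t T b) (lookup∘tabulate s (λ a → tabulate t λ b → f (a , b)) a))
  (lookup∘tabulate t (λ b → f (a , b)) b)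

-- Matrices indexed by the exponents of a bundle w of edges, multiplied along edges, whose two
-- exponents are complementary.
module Matrix (w : Shape) where
  Mat : Set
  Mat = Exp (w ⊗ w) → ℤ

  infixr 7 _⊙_
  _⊙_ : Mat → Mat → Mat
  (f ⊙ g) (a , c) = ∑ w λ b → f (a , b) · g (complement w b , c)

  ⊙-cong : ∀ {f f′ g g′ : Mat} → (∀ a → f a ≡ f′ a) → (∀ a → g a ≡ g′ a) → ∀ a → (f ⊙ g) a ≡ (f′ ⊙ g′) a
  ⊙-cong f≗ g≗ (a , c) = ∑-cong w λ b → cong₂ _·_ (f≗ (a , b)) (g≗ (complement w b , c))

  -- f ^¹⁺ m is the power of f with exponent suc m: there is no need for an identity matrix.
  infixl 8 _^¹⁺_
  _^¹⁺_ : Mat → ℕ → Mat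
  f ^¹⁺ zero  = f
  f ^¹⁺ suc m = f ⊙ f ^¹⁺ m

  -- Closing a chain through the map `r`; the closing edges, too, join complementary exponents.
  twistedTrace : (Exp w → Exp w) → Mat → ℤ
  twistedTrace r f = ∑ w λ b → f (r b , complement w b)

  module _ (k : ℤ) (f : Mat) (cube : ∀ a → (f ⊙ f ⊙ f) a ≡ k · f a) where
    ^¹⁺-recurrence : ∀ m a → (f ^¹⁺ suc (suc m)) a ≡ k · (f ^¹⁺ m) a
    ^¹⁺-recurrence zero    a = cube a
    ^¹⁺-recurrence (suc m) (a , c) = trans
      (∑-cong w λ b → trans
        (cong (f (a , b) ·_) (^¹⁺-recurrence m (complement w b , c)))
        (x∙yz≈y∙xz (f (a , b)) k ((f ^¹⁺ m) (complement w b , c))))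
      (sym (*-distribˡ-∑ w k λ b → f (a , b) · (f ^¹⁺ m) (complement w b , c)))

    -- The recurrence relates each trace, up to the factor `k`, to the one two powers below, so the
    -- first two powers decide.
    twistedTrace≢0 : ∀ r → k ≢ 0ℤ → twistedTrace r f ≢ 0ℤ → twistedTrace r (f ⊙ f) ≢ 0ℤ →
      ∀ m → twistedTrace r (f ^¹⁺ m) ≢ 0ℤ
    twistedTrace≢0 r k≢0 ≢0 ≢0′ zero          = ≢0
    twistedTrace≢0 r k≢0 ≢0 ≢0′ (suc zero)    = ≢0′
    twistedTrace≢0 r k≢0 ≢0 ≢0′ (suc (suc m)) eq =
      i*j≢0 k≢0 (twistedTrace≢0 r k≢0 ≢0 ≢0′ m) (trans
        (*-distribˡ-∑ w k λ b → (f ^¹⁺ m) (r b , complement w b))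
        (trans (sym (∑-cong w λ b → ^¹⁺-recurrence m (r b , complement w b))) eq))

  memo : Mat → Mat
  memo f = lookup (w ⊗ w) (tabulate (w ⊗ w) f)

  memo≗ : ∀ f a → memo f a ≡ f a
  memo≗ = lookup∘tabulate (w ⊗ w)

  -- Tables are passed as arguments, so that the type checker evaluates their entries only once.
  memo-cube? : ∀ k f → Dec (∀ a → (memo f ⊙ memo (memo f ⊙ memo f)) a ≡ k · memo f a)
  memo-cube? k f = square (tabulate (w ⊗ w) f)
    where
    compare : (T U : Table (w ⊗ w) ℤ) → let g = lookup (w ⊗ w) T in
      Dec (∀ a → (g ⊙ lookup (w ⊗ w) U) a ≡ k · g a)
    compare T U = ∀-dec (w ⊗ w) λ a → _ ≟ _

    square : (T : Table (w ⊗ w) ℤ) → let g = lookup (w ⊗ w) T in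
      Dec (∀ a → (g ⊙ memo (g ⊙ g)) a ≡ k · g a)
    square T = compare T (tabulate (w ⊗ w) (lookup (w ⊗ w) T ⊙ lookup (w ⊗ w) T))

  cube-sound : ∀ k f → True (memo-cube? k f) → ∀ a → (f ⊙ f ⊙ f) a ≡ k · f a
  cube-sound k f ok a = trans (sym (⊙-cong (memo≗ f) square≗ a))
    (trans (toWitness {a? = memo-cube? k f} ok a) (cong (k ·_) (memo≗ f a)))
    where
    square≗ : ∀ a → memo (memo f ⊙ memo f) a ≡ (f ⊙ f) a
    square≗ a = trans (memo≗ (memo f ⊙ memo f) a) (⊙-cong (memo≗ f) (memo≗ f) a)

-- Fibres and their transfer matrix

-- One edge for each of the three strands. Fibre r consists of the indices r, r + k and r + 2k.
W : Shape
W = (∙ ⊗ ∙) ⊗ ∙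

component : ∀ {A} → Tree A W → Fin 3 → A
component ((x , y) , z) 0F = x
component ((x , y) , z) 1F = y
component ((x , y) , z) 2F = z

rotate : ∀ {A} → Tree A W → Tree A W
rotate ((x , y) , z) = (z , x) , y

rotateᴵ : Iso W W
rotateᴵ = swapᴵ ⨾ assocᴵ

-- A strand of a fibre is an outer vertex, its spoke and the inner vertex; here x, y are the
-- colours of the outer edges and r, p those of the inner edges.
Strand : Palette → Tree ℕ ((∙ ⊗ ∙) ⊗ (∙ ⊗ ∙)) → Set
Strand L ((x , y) , (r , p)) = ∃ λ c → _∈ₚ_ {∙} c L × (Distinct x y c × Distinct r p c)

-- The superscript ᵗ marks the tensors that do not depend on the lists.
strandᵗ : Exp ((∙ ⊗ ∙) ⊗ (∙ ⊗ ∙)) → ℤ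
strandᵗ ((a , b) , (d , e)) = ∑ ∙ λ c → ε a b c · ε d e (opposite c)

strand : ∀ L → Rep ((∙ ⊗ ∙) ⊗ (∙ ⊗ ∙)) 4 strandᵗ (Strand L)
strand L = contract ∙ (relabel interchangeᴵ (vertex ⊠ vertex)) L

record Palettes : Set where
  field outers spokes inners : Tree Palette W

open Palettes

-- The inner edge s joins the inner vertices of the strands s and next s. The outer edges with
-- colours x enter the fibre and those with colours y leave it.
record Fibre (L : Palettes) (x y : Tree ℕ W) : Set where
  field
    spokeColours innerColours : Tree ℕ W
    spoke∈  : _∈ₚ_ {W} spokeColours (spokes L)
    inner∈  : _∈ₚ_ {W} innerColours (inners L)
    outer-vertex : ∀ s →
      Distinct (component x s) (component y s) (component spokeColours s)
    inner-vertex : ∀ s →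
      Distinct (component innerColours s) (component (rotate innerColours) s) (component spokeColours s)

-- `d`, `e`, `f` are the exponents of the three inner edges at their first ends. Each edge reaches
-- the next strand with the complementary exponent, so strand 0 sees `opposite f`.
fibreᵗ : Exp (W ⊗ W) → ℤ
fibreᵗ (((a , b) , c) , ((a′ , b′) , c′)) = ∑ W λ ((d , e) , f) →
  (strandᵗ ((a , a′) , (d , opposite f)) · strandᵗ ((b , b′) , (e , opposite d)))
    · strandᵗ ((c , c′) , (f , opposite e))

unzipᴵ : ∀ {s t s′ t′ q r q′ r′} →
  Iso (((s ⊗ s′) ⊗ (t ⊗ t′)) ⊗ ((q ⊗ q′) ⊗ (r ⊗ r′)))
      (((s ⊗ t) ⊗ (q ⊗ r)) ⊗ ((s′ ⊗ t′) ⊗ (q′ ⊗ r′)))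
unzipᴵ = (interchangeᴵ ⊗ᴵ interchangeᴵ) ⨾ interchangeᴵ

-- Degrees: a vertex contributes 3 and a joined edge removes 2, so a strand has 3 + 3 - 2 = 4 and a
-- fibre 3 · 4 - 3 · 2 = 6.
fibre : ∀ L → Rep (W ⊗ W) 6 fibreᵗ (λ (x , y) → Fibre L x y)
fibre L = weaken collect
  (contract W
    -- `rotateᴵ` moves the second ends of the inner edges to the next strand, which closes the
    -- triangle; unzipping then groups the ends by strand.
    (relabel ((idᴵ ⊗ᴵ (idᴵ ⊗ᴵ rotateᴵ)) ⨾ unzipᴵ ⨾ (unzipᴵ ⊗ᴵ idᴵ))
      ((strand (component (spokes L) 0F) ⊠ strand (component (spokes L) 1F))
        ⊠ strand (component (spokes L) 2F)))
    (inners L))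
  where
  collect : ∀ ξ → _ → Fibre L (proj₁ ξ) (proj₂ ξ)
  collect _ (ι , ι∈ , ((s₀ , s₀∈ , u₀ , v₀) , (s₁ , s₁∈ , u₁ , v₁)) , (s₂ , s₂∈ , u₂ , v₂)) = record
    { spokeColours = (s₀ , s₁) , s₂
    ; innerColours = ι
    ; spoke∈       = (s₀∈ , s₁∈) , s₂∈
    ; inner∈       = ι∈
    ; outer-vertex = λ { 0F → u₀ ; 1F → u₁ ; 2F → u₂ }
    ; inner-vertex = λ { 0F → v₀ ; 1F → v₁ ; 2F → v₂ }
    }

-- A chain of suc m consecutive fibres.
Strip : ∀ m → (Fin (suc m) → Palettes) → Tree ℕ W → Tree ℕ W → Set
Strip zero    L x y = Fibre (L zero) x y
Strip (suc m) L x y = ∃ λ z → _∈ₚ_ {W} z (outers (L zero)) × (Fibre (L zero) x z × Strip m (L ∘ suc) z y)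

open Matrix W

strip : ∀ m L → Rep (W ⊗ W) 6 (fibreᵗ ^¹⁺ m) (λ (x , y) → Strip m L x y)
strip zero    L = fibre (L zero)
strip (suc m) L = contract W
  (relabel (interchangeᴵ ⨾ (idᴵ ⊗ᴵ swapᴵ)) (fibre (L zero) ⊠ strip m (L ∘ suc)))
  (outers (L zero))

-- The last fibre is joined to the first with a shift of the strands.
closed-strip : ∀ m L → twistedTrace rotate (fibreᵗ ^¹⁺ m) ≢ 0ℤ → (M : Tree Palette W) →
  ∃ λ y → _∈ₚ_ {W} y M × Strip m L (rotate y) y
-- No free end is left: over `∅` the polynomial is a constant, a nonzero multiple of the trace.
closed-strip m L ≢0 M = sound R tt λ eq → i*j≢0 (scale≢0 R) ≢0
  (trans (sym (top R tt z≤n)) (trans (sym (ℤ.*-identityʳ (coeff R tt))) eq))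
  where
  R : Rep ∅ 0 (λ _ → twistedTrace rotate (fibreᵗ ^¹⁺ m))
    (λ _ → ∃ λ y → _∈ₚ_ {W} y M × Strip m L (rotate y) y)
  R = contract W (relabel (unitᴵ ⨾ (rotateᴵ ⊗ᴵ idᴵ)) (strip m L)) M

cube : ∀ a → (fibreᵗ ⊙ fibreᵗ ⊙ fibreᵗ) a ≡ (- + 3) · fibreᵗ a
cube = cube-sound (- + 3) fibreᵗ tt

strip-trace≢0 : ∀ m → twistedTrace rotate (fibreᵗ ^¹⁺ m) ≢ 0ℤ
-- The absurd patterns are checked by evaluation: -3 and the traces for one and two fibres come out
-- as nonzero integers.
strip-trace≢0 = twistedTrace≢0 (- + 3) fibreᵗ cube rotate (λ ()) (λ ()) (λ ())

previous : ∀ {A : Set} {m} → A → (Fin (suc m) → A) → Fin (suc m) → A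
previous x out zero    = x
previous x out (suc r) = out (inject₁ r)

-- Turns the nested existentials of a strip into one family indexed by the fibres. The bundle `y`
-- leaving the last fibre is not among them and is adjoined here.
unroll : ∀ m L {x y} → Strip m L x y → _∈ₚ_ {W} y (outers (L (fromℕ m))) →
  ∃ λ (out : Fin (suc m) → Tree ℕ W) → out (fromℕ m) ≡ y
    × (∀ r → _∈ₚ_ {W} (out r) (outers (L r)))
    × (∀ r → Fibre (L r) (previous x out r) (out r))
unroll zero    L {x} {y} F y∈ = (λ _ → y) , refl , (λ { zero → y∈ }) , λ { zero → F }
unroll (suc m) L {x} {y} (z , z∈ , F , S) y∈ with unroll m (L ∘ suc) S y∈
... | out , out≡y , out∈ , Fs = out′ , out≡y , out′∈ , Fs′
  where
  out′ : Fin (suc (suc m)) → Tree ℕ W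
  out′ zero    = z
  out′ (suc r) = out r

  out′∈ : ∀ r → _∈ₚ_ {W} (out′ r) (outers (L r))
  out′∈ zero    = z∈
  out′∈ (suc r) = out∈ r

  Fs′ : ∀ r → Fibre (L r) (previous x out′ r) (out′ r)
  Fs′ zero          = F
  Fs′ (suc zero)    = Fs zero
  Fs′ (suc (suc r)) = Fs (suc r)

-- Edge colourings of GP(3k,k)

lookup-injective : ∀ {A : Set} {xs : List A} → Unique xs →
  ∀ {i j} → List.lookup xs i ≡ List.lookup xs j → i ≡ j
lookup-injective (x∉ ∷ xs!) {zero}  {zero}  eq = refl
lookup-injective (x∉ ∷ xs!) {zero}  {suc j} eq = contradiction eq (All.lookup x∉ (∈-lookup j))
lookup-injective (x∉ ∷ xs!) {suc i} {zero}  eq = contradiction (sym eq) (All.lookup x∉ (∈-lookup i))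
lookup-injective (x∉ ∷ xs!) {suc i} {suc j} eq = cong suc (lookup-injective xs! eq)

enumerate : ∀ {ℓ} (xs : List ℕ) → Unique xs → length xs ≡ ℓ →
  ∃ λ (f : Fin ℓ → ℕ) → Injective _≡_ _≡_ f × (∀ i → f i ∈ xs)
enumerate xs xs! refl = List.lookup xs , lookup-injective xs! , ∈-lookup

-- Ordinary colouring is the case of equal lists, here 0, ..., ℓ - 1.
choosable⇒colourable : ∀ G {ℓ} → EdgeChoosable G ℓ → EdgeColourable G ℓ
choosable⇒colourable G {ℓ} choosable
  with choosable (λ _ → upTo ℓ) (λ _ → upTo⁺ ℓ) (λ _ → length-upTo ℓ)
... | c , proper , c∈ = (λ e → fromℕ< (∈-upTo⁻ (c∈ e)))
  , λ {e} {f} e≢f xe xf eq → proper e≢f xe xf (fromℕ<-injective (c e) (c f) _ _ eq)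

degree≤colours : ∀ G {d ℓ} x (e : Fin d → SimpleGraph.E G) → Injective _≡_ _≡_ e →
  (∀ i → SimpleGraph._endOf_ G x (e i)) → EdgeColourable G ℓ → d ≤ ℓ
degree≤colours G x e e-injective e∋x (c , proper) = injective⇒≤ ce-injective
  where
  ce-injective : Injective _≡_ _≡_ (λ i → c (e i))
  ce-injective {i} {j} eq with i Fin.≟ j
  ... | yes i≡j = i≡j
  ... | no  i≢j = contradiction eq (proper (i≢j ∘ e-injective) (e∋x i) (e∋x j))

-- Shifts modulo n in coordinates of strand and fibre

module _ {n : ℕ} where
  ⊕-unwrapped : ∀ (i j : Fin (suc n)) d → toℕ i ℕ.+ d ≡ toℕ j → i ⊕ d ≡ j
  ⊕-unwrapped i j d eq = toℕ-injective
    (trans (toℕ-⊕ i d) (trans (cong (ℕ._% suc n) eq) (m<n⇒m%n≡m (toℕ<n j))))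

  ⊕-wrapped : ∀ (i j : Fin (suc n)) d → toℕ i ℕ.+ d ≡ toℕ j ℕ.+ suc n → i ⊕ d ≡ j
  ⊕-wrapped i j d eq = toℕ-injective (trans (toℕ-⊕ i d)
    (trans (cong (ℕ._% suc n) eq) (trans ([m+n]%n≡m%n (toℕ j) (suc n)) (m<n⇒m%n≡m (toℕ<n j)))))

  ⊕-inverse : ∀ {d} → d ≤ suc n → (i : Fin (suc n)) → (i ⊕ d) ⊕ (suc n ℕ.∸ d) ≡ i
  ⊕-inverse {d} d≤n i = toℕ-injective (begin
    toℕ (i ⊕ d ⊕ d′)              ≡⟨ toℕ-⊕ (i ⊕ d) d′ ⟩
    (toℕ (i ⊕ d) ℕ.+ d′) % N      ≡⟨ cong (λ x → (x ℕ.+ d′) % N) (toℕ-⊕ i d) ⟩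
    ((toℕ i ℕ.+ d) % N ℕ.+ d′) % N ≡⟨ [m%n+o]%n (toℕ i ℕ.+ d) d′ ⟩
    (toℕ i ℕ.+ d ℕ.+ d′) % N      ≡⟨ cong (_% N) (trans (ℕ.+-assoc (toℕ i) d d′)
                                       (cong (toℕ i ℕ.+_) (ℕ.m+[n∸m]≡n d≤n))) ⟩
    (toℕ i ℕ.+ N) % N             ≡⟨ [m+n]%n≡m%n (toℕ i) N ⟩
    toℕ i % N                     ≡⟨ m<n⇒m%n≡m (toℕ<n i) ⟩
    toℕ i                         ∎)
    where
    open ≡-Reasoning
    N d′ : ℕ
    N = suc n
    d′ = N ℕ.∸ d
    [m%n+o]%n : ∀ a b → (a % N ℕ.+ b) % N ≡ (a ℕ.+ b) % N
    [m%n+o]%n a b = trans (%-distribˡ-+ (a % N) b N)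
      (trans (cong (λ x → (x ℕ.+ b % N) % N) (m%n%n≡m%n a N)) (sym (%-distribˡ-+ a b N)))

  -- Used to show that two outer edges, or two inner edges, with the same second end are equal.
  ⊕-injective : ∀ {d} → d ≤ suc n → (i j : Fin (suc n)) → i ⊕ d ≡ j ⊕ d → i ≡ j
  ⊕-injective {d} d≤n i j eq =
    trans (sym (⊕-inverse d≤n i)) (trans (cong (_⊕ (suc n ℕ.∸ d)) eq) (⊕-inverse d≤n j))

next : Fin 3 → Fin 3
next 0F = 1F
next 1F = 2F
next 2F = 0F

component-rotate : ∀ {A} (t : Tree A W) s → component (rotate t) (next s) ≡ component t s
component-rotate t 0F = refl
component-rotate t 1F = refl
component-rotate t 2F = refl

-- The index s · k + r of strand s in fibre r. Adding k changes the strand and keeps the fibre;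
-- adding 1 leads to the next fibre of the same strand, except after the last fibre.
position : ∀ {k} → Fin 3 → Fin k → Fin (3 * k)
position {k} = combine {3} {k}

module _ (m : ℕ) where
  private
    k : ℕ
    k = suc m

  toℕ-position-next : ∀ s (r : Fin k) → toℕ (position s r) ℕ.+ k ≡ toℕ (position (next s) r)
    ⊎ toℕ (position s r) ℕ.+ k ≡ toℕ (position (next s) r) ℕ.+ 3 * k
  toℕ-position-next s r rewrite toℕ-combine {3} {k} s r | toℕ-combine {3} {k} (next s) r = go s
    where
    go : ∀ s → k * toℕ s ℕ.+ toℕ r ℕ.+ k ≡ k * toℕ (next s) ℕ.+ toℕ r
      ⊎ k * toℕ s ℕ.+ toℕ r ℕ.+ k ≡ k * toℕ (next s) ℕ.+ toℕ r ℕ.+ 3 * k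
    go 0F = inj₁ (lemma k (toℕ r))
      where
      lemma : ∀ k r → k * 0 ℕ.+ r ℕ.+ k ≡ k * 1 ℕ.+ r
      lemma = ℕ-Solver.solve-∀
    go 1F = inj₁ (lemma k (toℕ r))
      where
      lemma : ∀ k r → k * 1 ℕ.+ r ℕ.+ k ≡ k * 2 ℕ.+ r
      lemma = ℕ-Solver.solve-∀
    go 2F = inj₂ (lemma k (toℕ r))
      where
      lemma : ∀ k r → k * 2 ℕ.+ r ℕ.+ k ≡ k * 0 ℕ.+ r ℕ.+ 3 * k
      lemma = ℕ-Solver.solve-∀

  position-⊕-k : ∀ s (r : Fin k) → position s r ⊕ k ≡ position (next s) r
  position-⊕-k s r = [ ⊕-unwrapped i j k , ⊕-wrapped i j k ]′ (toℕ-position-next s r)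
    where
    i j : Fin (3 * k)
    i = position s r
    j = position (next s) r

  position-⊕-suc : ∀ s (r : Fin m) → position s (inject₁ r) ⊕ 1 ≡ position s (suc r)
  position-⊕-suc s r = ⊕-unwrapped (position s (inject₁ r)) (position s (suc r)) 1 (begin
    toℕ (position s (inject₁ r)) ℕ.+ 1          ≡⟨ cong (ℕ._+ 1) (toℕ-combine {3} {k} s (inject₁ r)) ⟩
    k * toℕ s ℕ.+ toℕ (inject₁ r) ℕ.+ 1     ≡⟨ cong (λ x → k * toℕ s ℕ.+ x ℕ.+ 1) (toℕ-inject₁ r) ⟩
    k * toℕ s ℕ.+ toℕ r ℕ.+ 1               ≡⟨ ℕ.+-assoc (k * toℕ s) (toℕ r) 1 ⟩
    k * toℕ s ℕ.+ (toℕ r ℕ.+ 1)             ≡⟨ cong (k * toℕ s ℕ.+_) (ℕ.+-comm (toℕ r) 1) ⟩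
    k * toℕ s ℕ.+ suc (toℕ r)                ≡⟨ toℕ-combine {3} {k} s (suc r) ⟨
    toℕ (position s (suc r))             ∎)
    where open ≡-Reasoning

  -- One step beyond the last fibre is a step of length k from the first, so it changes the strand.
  -- This is the shift that closes the strip.
  position-⊕-last : ∀ s → position s (fromℕ m) ⊕ 1 ≡ position (next s) zero
  position-⊕-last s =
    [ (λ eq → ⊕-unwrapped i j 1 (trans step eq)) , (λ eq → ⊕-wrapped i j 1 (trans step eq)) ]′
    (toℕ-position-next s zero)
    where
    i j : Fin (3 * k)
    i = position s (fromℕ m)
    j = position (next s) zero

    open ≡-Reasoning
    step : toℕ (position s (fromℕ m)) ℕ.+ 1 ≡ toℕ (position s zero) ℕ.+ k
    step = begin
      toℕ (position s (fromℕ m)) ℕ.+ 1         ≡⟨ cong (ℕ._+ 1) (toℕ-combine {3} {k} s (fromℕ m)) ⟩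
      k * toℕ s ℕ.+ toℕ (fromℕ m) ℕ.+ 1    ≡⟨ cong (λ x → k * toℕ s ℕ.+ x ℕ.+ 1) (toℕ-fromℕ m) ⟩
      k * toℕ s ℕ.+ m ℕ.+ 1                 ≡⟨ ℕ.+-assoc (k * toℕ s) m 1 ⟩
      k * toℕ s ℕ.+ (m ℕ.+ 1)               ≡⟨ cong (k * toℕ s ℕ.+_) (ℕ.+-comm m 1) ⟩
      k * toℕ s ℕ.+ k                        ≡⟨ cong (ℕ._+ k) (ℕ.+-identityʳ (k * toℕ s)) ⟨
      k * toℕ s ℕ.+ 0 ℕ.+ k                 ≡⟨ cong (ℕ._+ k) (toℕ-combine {3} {k} s zero) ⟨
      toℕ (position s zero) ℕ.+ k       ∎

-- Lower bound and list colouring for GP(3k,k)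

module _ (m : ℕ) (1≤k : 1 ≤ suc m) where
  private
    k n : ℕ
    k = suc m
    n = 3 * k

    G : SimpleGraph
    G = GP n k 1≤k (2k<3k 1≤k)

    k≤n : k ≤ n
    k≤n = ℕ.m≤m+n k (2 * k)

    1≤n : 1 ≤ n
    1≤n = s≤s z≤n

  -- The conditions at a vertex are indexed by the edge arriving at `i ⊕ 1` or `i ⊕ k`, and the
  -- first two hypotheses treat first ends, so that no shift has to be inverted.
  proper-from-local : (c : GPEdge n → ℕ) →
    (∀ i → c (outer i) ≢ c (spoke i)) →
    (∀ i → c (inner i) ≢ c (spoke i)) →
    (∀ i → Distinct (c (outer i)) (c (outer (i ⊕ 1))) (c (spoke (i ⊕ 1)))) →
    (∀ i → Distinct (c (inner (i ⊕ k))) (c (inner i)) (c (spoke (i ⊕ k)))) →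
    ProperEdgeColouring G c
  proper-from-local c out≢spoke in≢spoke at-u at-v = proper
    where
    u-injective : ∀ {i j : Fin n} → u i ≡ u j → i ≡ j
    u-injective refl = refl

    v-injective : ∀ {i j : Fin n} → v i ≡ v j → i ≡ j
    v-injective refl = refl

    proper : ProperEdgeColouring G c
    proper {outer i} {outer j} e≢f (inj₁ refl) (inj₁ refl) = contradiction refl e≢f
    proper {outer i} {outer j} e≢f (inj₁ refl) (inj₂ refl) = ≢-sym (proj₁ (at-u j))
    proper {outer i} {outer j} e≢f (inj₂ refl) (inj₁ refl) = proj₁ (at-u i)
    proper {outer i} {outer j} e≢f (inj₂ refl) (inj₂ eq) =
      contradiction (cong outer (⊕-injective 1≤n i j (u-injective eq))) e≢f
    proper {outer i} {spoke j} e≢f (inj₁ refl) (inj₁ refl) = out≢spoke i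
    proper {outer i} {spoke j} e≢f (inj₂ refl) (inj₁ refl) = proj₁ (proj₂ (at-u i))
    proper {outer i} {spoke j} e≢f (inj₁ refl) (inj₂ ())
    proper {outer i} {spoke j} e≢f (inj₂ refl) (inj₂ ())
    proper {outer i} {inner j} e≢f (inj₁ refl) (inj₁ ())
    proper {outer i} {inner j} e≢f (inj₁ refl) (inj₂ ())
    proper {outer i} {inner j} e≢f (inj₂ refl) (inj₁ ())
    proper {outer i} {inner j} e≢f (inj₂ refl) (inj₂ ())
    proper {spoke i} {spoke j} e≢f (inj₁ refl) (inj₁ refl) = contradiction refl e≢f
    proper {spoke i} {spoke j} e≢f (inj₂ refl) (inj₂ refl) = contradiction refl e≢f
    proper {spoke i} {spoke j} e≢f (inj₁ refl) (inj₂ ())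
    proper {spoke i} {spoke j} e≢f (inj₂ refl) (inj₁ ())
    proper {inner i} {inner j} e≢f (inj₁ refl) (inj₁ refl) = contradiction refl e≢f
    proper {inner i} {inner j} e≢f (inj₁ refl) (inj₂ refl) = proj₁ (at-v j)
    proper {inner i} {inner j} e≢f (inj₂ refl) (inj₁ refl) = ≢-sym (proj₁ (at-v i))
    proper {inner i} {inner j} e≢f (inj₂ refl) (inj₂ eq) =
      contradiction (cong inner (⊕-injective k≤n i j (v-injective eq))) e≢f
    proper {inner i} {spoke j} e≢f (inj₁ refl) (inj₂ refl) = in≢spoke i
    proper {inner i} {spoke j} e≢f (inj₂ refl) (inj₂ refl) = proj₂ (proj₂ (at-v i))
    proper {inner i} {spoke j} e≢f (inj₁ refl) (inj₁ ())
    proper {inner i} {spoke j} e≢f (inj₂ refl) (inj₁ ())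
    proper {spoke i} {outer j} e≢f (inj₁ refl) (inj₁ refl) = ≢-sym (out≢spoke j)
    proper {spoke i} {outer j} e≢f (inj₁ refl) (inj₂ refl) = ≢-sym (proj₁ (proj₂ (at-u j)))
    proper {spoke i} {outer j} e≢f (inj₂ refl) (inj₁ ())
    proper {spoke i} {outer j} e≢f (inj₂ refl) (inj₂ ())
    proper {spoke i} {inner j} e≢f (inj₂ refl) (inj₁ refl) = ≢-sym (in≢spoke j)
    proper {spoke i} {inner j} e≢f (inj₂ refl) (inj₂ refl) = ≢-sym (proj₂ (proj₂ (at-v j)))
    proper {spoke i} {inner j} e≢f (inj₁ refl) (inj₁ ())
    proper {spoke i} {inner j} e≢f (inj₁ refl) (inj₂ ())
    proper {inner i} {outer j} e≢f (inj₁ refl) (inj₁ ())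
    proper {inner i} {outer j} e≢f (inj₁ refl) (inj₂ ())
    proper {inner i} {outer j} e≢f (inj₂ refl) (inj₁ ())
    proper {inner i} {outer j} e≢f (inj₂ refl) (inj₂ ())

  colourable⇒3≤ : ∀ ℓ → EdgeColourable G ℓ → 3 ≤ ℓ
  colourable⇒3≤ ℓ = degree≤colours G (u j) star star-injective star∋
    where
    i j : Fin n
    i = zero
    -- The vertex is taken as a successor, so that `outer i` ends there by definition.
    j = i ⊕ 1

    i≢j : i ≢ j
    i≢j = i≢i⊕d i (s≤s z≤n) (ℕ.≤-<-trans 1≤k (ℕ.m<m+n k (s≤s z≤n)))

    star : Fin 3 → GPEdge n
    star 0F = outer i
    star 1F = outer j
    star 2F = spoke j

    outer-injective : ∀ {i j : Fin n} → outer i ≡ outer j → i ≡ j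
    outer-injective refl = refl

    star-injective : Injective _≡_ _≡_ star
    star-injective {0F} {0F} _  = refl
    star-injective {1F} {1F} _  = refl
    star-injective {2F} {2F} _  = refl
    star-injective {0F} {1F} eq = contradiction (outer-injective eq) i≢j
    star-injective {1F} {0F} eq = contradiction (outer-injective (sym eq)) i≢j
    star-injective {0F} {2F} ()
    star-injective {1F} {2F} ()
    star-injective {2F} {0F} ()
    star-injective {2F} {1F} ()

    star∋ : ∀ s → SimpleGraph._endOf_ G (u j) (star s)
    star∋ 0F = inj₂ refl
    star∋ 1F = inj₁ refl
    star∋ 2F = inj₁ refl

  choosable : EdgeChoosable G 3
  choosable L unique length≡3 = c , proper , c∈
    where
    palette : GPEdge n → Palette
    palette e = let f , f-injective , _ = enumerate (L e) (unique e) (length≡3 e) in f , f-injective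

    bundle : (Fin n → GPEdge n) → Fin k → Tree Palette W
    bundle edge r = (p 0F , p 1F) , p 2F
      where
      p : Fin 3 → Palette
      p s = palette (edge (position s r))

    palettes : Fin k → Palettes
    palettes r = record { outers = bundle outer r ; spokes = bundle spoke r ; inners = bundle inner r }

    closed : ∃ λ y → _∈ₚ_ {W} y (bundle outer (fromℕ m)) × Strip m palettes (rotate y) y
    closed = closed-strip m palettes (strip-trace≢0 m) (bundle outer (fromℕ m))

    y : Tree ℕ W
    y = proj₁ closed

    unrolled : ∃ λ (out : Fin k → Tree ℕ W) → out (fromℕ m) ≡ y
      × (∀ r → _∈ₚ_ {W} (out r) (bundle outer r))
      × (∀ r → Fibre (palettes r) (previous (rotate y) out r) (out r))
    unrolled = unroll m palettes (proj₂ (proj₂ closed)) (proj₁ (proj₂ closed))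

    out : Fin k → Tree ℕ W
    out = proj₁ unrolled

    fibres : ∀ r → Fibre (palettes r) (previous (rotate y) out r) (out r)
    fibres = proj₂ (proj₂ (proj₂ unrolled))

    spokeOf innerOf : Fin k → Tree ℕ W
    spokeOf r = Fibre.spokeColours (fibres r)
    innerOf r = Fibre.innerColours (fibres r)

    colour : (Fin k → Tree ℕ W) → Fin n → ℕ
    colour t i = component (t (proj₂ (remQuot {3} k i))) (proj₁ (remQuot {3} k i))

    colour-position : ∀ t s r → colour t (position s r) ≡ component (t r) s
    colour-position t s r = cong (λ (s , r) → component (t r) s) (remQuot-combine {3} {k} s r)

    c : GPEdge n → ℕ
    c (outer i) = colour out i
    c (spoke i) = colour spokeOf i
    c (inner i) = colour innerOf i

    by-position : (P : Fin n → Set) → (∀ s r → P (position s r)) → ∀ i → P i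
    by-position P p i = subst P (combine-remQuot {3} k i)
      (p (proj₁ (remQuot {3} k i)) (proj₂ (remQuot {3} k i)))

    colour∈ : ∀ edge t → (∀ r → _∈ₚ_ {W} (t r) (bundle edge r)) → ∀ i → colour t i ∈ L (edge i)
    colour∈ edge t t∈ = by-position (λ i → colour t i ∈ L (edge i)) λ s r →
      subst (_∈ L (edge (position s r))) (sym (colour-position t s r)) (member s r (t∈ r))
      where
      palette∈ : ∀ e {x} → _∈ₚ_ {∙} x (palette e) → x ∈ L e
      palette∈ e (i , refl) = proj₂ (proj₂ (enumerate (L e) (unique e) (length≡3 e))) i

      member : ∀ s r → _∈ₚ_ {W} (t r) (bundle edge r) → component (t r) s ∈ L (edge (position s r))
      member 0F r ((p , _) , _) = palette∈ _ p
      member 1F r ((_ , p) , _) = palette∈ _ p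
      member 2F r (_ , p)       = palette∈ _ p

    c∈ : ∀ e → c e ∈ L e
    c∈ (outer i) = colour∈ outer out (proj₁ (proj₂ (proj₂ unrolled))) i
    c∈ (spoke i) = colour∈ spoke spokeOf (λ r → Fibre.spoke∈ (fibres r)) i
    c∈ (inner i) = colour∈ inner innerOf (λ r → Fibre.inner∈ (fibres r)) i

    Distinct-cong : ∀ {x x′ y y′ z z′} → x ≡ x′ → y ≡ y′ → z ≡ z′ → Distinct x′ y′ z′ → Distinct x y z
    Distinct-cong refl refl refl d = d

    out≢spoke : ∀ i → c (outer i) ≢ c (spoke i)
    out≢spoke = by-position (λ i → c (outer i) ≢ c (spoke i)) λ s r →
      subst₂ _≢_ (sym (colour-position out s r))
        (sym (colour-position spokeOf s r))
      (proj₂ (proj₂ (Fibre.outer-vertex (fibres r) s)))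

    in≢spoke : ∀ i → c (inner i) ≢ c (spoke i)
    in≢spoke = by-position (λ i → c (inner i) ≢ c (spoke i)) λ s r →
      subst₂ _≢_ (sym (colour-position innerOf s r))
        (sym (colour-position spokeOf s r))
      (proj₁ (proj₂ (Fibre.inner-vertex (fibres r) s)))

    at-u : ∀ i → Distinct (c (outer i)) (c (outer (i ⊕ 1))) (c (spoke (i ⊕ 1)))
    at-u = by-position (λ i → Distinct (c (outer i)) (c (outer (i ⊕ 1))) (c (spoke (i ⊕ 1)))) λ s r →
      step s r (view r)
      where
      step : ∀ s r → View r → let i = position s r in
        Distinct (c (outer i)) (c (outer (i ⊕ 1))) (c (spoke (i ⊕ 1)))
      step s _ (‵inject₁ r) = Distinct-cong
        (colour-position out s (inject₁ r))
        (trans (cong (colour out) (position-⊕-suc m s r)) (colour-position out s (suc r)))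
        (trans (cong (colour spokeOf) (position-⊕-suc m s r)) (colour-position spokeOf s (suc r)))
        (Fibre.outer-vertex (fibres (suc r)) s)
      -- At the seam the bundle `rotate y` enters the first fibre; its rotation matches the change
      -- of strand in `position-⊕-last`.
      step s _ ‵fromℕ = Distinct-cong
        (trans (colour-position out s (fromℕ m))
          (trans (cong (λ t → component t s) (proj₁ (proj₂ unrolled))) (sym (component-rotate y s))))
        (trans (cong (colour out) (position-⊕-last m s)) (colour-position out (next s) zero))
        (trans (cong (colour spokeOf) (position-⊕-last m s)) (colour-position spokeOf (next s) zero))
        (Fibre.outer-vertex (fibres zero) (next s))

    at-v : ∀ i → Distinct (c (inner (i ⊕ k))) (c (inner i)) (c (spoke (i ⊕ k)))
    at-v = by-position (λ i → Distinct (c (inner (i ⊕ k))) (c (inner i)) (c (spoke (i ⊕ k)))) λ s r →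
      Distinct-cong
      (trans (cong (colour innerOf) (position-⊕-k m s r)) (colour-position innerOf (next s) r))
      (trans (colour-position innerOf s r) (sym (component-rotate (innerOf r) s)))
      (trans (cong (colour spokeOf) (position-⊕-k m s r)) (colour-position spokeOf (next s) r))
      (Fibre.inner-vertex (fibres r) (next s))

    proper : ProperEdgeColouring G c
    proper = proper-from-local c out≢spoke in≢spoke at-u at-v

theorem2 : (k : ℕ) (1≤k : 1 ≤ k) →
    ∃ λ (m : ℕ) →
    IsChoiceIndex (GP (3 * k) k 1≤k (2k<3k 1≤k)) m
    × IsChromaticIndex (GP (3 * k) k 1≤k (2k<3k 1≤k)) m
theorem2 zero    ()
-- Both indices are 3: lists of length 3 suffice, and a vertex of degree 3 forbids fewer colours.
theorem2 (suc m) 1≤k = 3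
  , (choosable m 1≤k , λ ℓ ℓ-choosable → colourable⇒3≤ m 1≤k ℓ (choosable⇒colourable G ℓ-choosable))
  , (choosable⇒colourable G (choosable m 1≤k) , colourable⇒3≤ m 1≤k)
  where
  G : SimpleGraph
  G = GP (3 * suc m) (suc m) 1≤k (2k<3k 1≤k)
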